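{- Let $T$ and $B$ be lattice paths with steps $N=(0,1)$ and $E=(1,0)$ from the origin to a point $(x,y)\in\mathbb N^2$, with $T$ weakly above $B$, and let $k\ge 1$. Then the distribution of $(h_0,h_1,\dots,h_k)$ over $\mathcal P^k(T,B)$ is symmetric: for every permutation $\pi$ of $\{0,1,\dots,k\}$, $$\sum_{\mathbf P\in\mathcal P^k(T,B)}\prod_{i=0}^k z_i^{h_i(\mathbf P)}=\sum_{\mathbf P\in\mathcal P^k(T,B)}\prod_{i=0}^k z_i^{h_{\pi(i)}(\mathbf P)}.$$
   Context: $T$ weakly above $B$ means no point of $T$ is strictly below or strictly to the right of $B$. $\mathcal P(T,B)$ is the set of lattice paths with steps $N,E$ from the origin to $(x,y)$ lying weakly above $B$ and weakly below $T$. $\mathcal P^k(T,B)$ is the set of $k$-tuples $\mathbf P=(P_1,\dots,P_k)$ with each $P_i\in\mathcal P(T,B)$ and $P_i$ weakly above $P_{i+1}$ for $1\le i\le k-1$. With the convention $P_0=T$ and $P_{k+1}=B$, $h_i(\mathbf P)$ (for $0\le i\le k$) is the number of east steps on which $P_i$ and $P_{i+1}$ coincide. -}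

module Defs where

open import Data.Nat using (ℕ; zero; suc; _+_; _≤ᵇ_; _≡ᵇ_)
open import Data.Bool using (Bool; true; false; _∧_; if_then_else_)
open import Data.List using (List; []; _∷_; map; _++_; concatMap; filterᵇ; foldr; length)
open import Data.Vec using (Vec; []; _∷_; lookup; _∷ʳ_)
open import Data.Fin using (Fin; inject₁) renaming (suc to fsuc)
open import Algebra.Bundles using (CommutativeSemiring)
open import Level using (Level)

data Step : Set where
  N E : Step

Path : Set
Path = List Step

isN : Step → Bool
isN N = true
isN E = false

isE : Step → Bool
isE N = false
isE E = true

countE : Path → ℕ
countE []       = 0
countE (s ∷ p) = (if isE s then 1 else 0) + countE p

countN : Path → ℕ
countN []       = 0
countN (s ∷ p) = (if isN s then 1 else 0) + countN p

endsAtᵇ : ℕ → ℕ → Path → Bool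
endsAtᵇ x y p = (countE p ≡ᵇ x) ∧ (countN p ≡ᵇ y)

words : ℕ → List Path
words zero    = [] ∷ []
words (suc n) = concatMap (λ w → (N ∷ w) ∷ (E ∷ w) ∷ []) (words n)

allPaths : ℕ → ℕ → List Path
allPaths x y = filterᵇ (endsAtᵇ x y) (words (x + y))

-- P weakly above Q (paths of equal length from the origin): after every
-- number j of steps, P has taken at least as many N steps as Q, i.e. no
-- point of P is strictly below / strictly right of Q.
-- Auxiliary: a, b are the N-counts of the prefixes read so far.
aboveAux : ℕ → ℕ → Path → Path → Bool
aboveAux a b []       []       = true
aboveAux a b (s ∷ p) (t ∷ q) =
  let a' = (if isN s then 1 else 0) + a
      b' = (if isN t then 1 else 0) + b
  in (b' ≤ᵇ a') ∧ aboveAux a' b' p q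
aboveAux a b _        _        = false

weaklyAboveᵇ : Path → Path → Bool
weaklyAboveᵇ P Q = aboveAux 0 0 P Q

-- Number of east steps (unit segments (a,b)→(a+1,b)) common to P and Q.
-- Step number j of a path starts at a point with coordinate sum j, so a common
-- segment is a common step index j where both take E from the same point,
-- i.e. with equal numbers of previous N steps.
commonEAux : ℕ → ℕ → Path → Path → ℕ
commonEAux a b (s ∷ p) (t ∷ q) =
  (if isE s ∧ isE t ∧ (a ≡ᵇ b) then 1 else 0)
  + commonEAux ((if isN s then 1 else 0) + a) ((if isN t then 1 else 0) + b) p q
commonEAux a b _ _ = 0

commonE : Path → Path → ℕ
commonE P Q = commonEAux 0 0 P Q

pathsBetween : ℕ → ℕ → Path → Path → List Path
pathsBetween x y T B =
  filterᵇ (λ P → weaklyAboveᵇ T P ∧ weaklyAboveᵇ P B) (allPaths x y)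

tuples : {A : Set} (k : ℕ) → List A → List (Vec A k)
tuples zero    xs = [] ∷ []
tuples (suc k) xs = concatMap (λ a → map (a ∷_) (tuples k xs)) xs

chainᵇ : {k : ℕ} → Vec Path k → Bool
chainᵇ []            = true
chainᵇ (P ∷ [])      = true
chainᵇ (P ∷ Q ∷ Ps) = weaklyAboveᵇ P Q ∧ chainᵇ (Q ∷ Ps)

multiPaths : ℕ → ℕ → Path → Path → (k : ℕ) → List (Vec Path k)
multiPaths x y T B k = filterᵇ chainᵇ (tuples k (pathsBetween x y T B))

h : {k : ℕ} → Path → Path → Vec Path k → Fin (suc k) → ℕ
h {k} T B Ps i = commonE (lookup ext (inject₁ i)) (lookup ext (fsuc i))
  where
  ext : Vec Path (suc (suc k))
  ext = T ∷ (Ps ∷ʳ B)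

module _ {c ℓ : Level} (R : CommutativeSemiring c ℓ) where
  open CommutativeSemiring R using (Carrier; 1#; 0#) renaming (_+_ to _⊕_; _*_ to _⊗_)

  pow : Carrier → ℕ → Carrier
  pow a zero    = 1#
  pow a (suc n) = a ⊗ pow a n

  prodFin : (n : ℕ) → (Fin n → Carrier) → Carrier
  prodFin zero    f = 1#
  prodFin (suc n) f = f Data.Fin.zero ⊗ prodFin n (λ i → f (fsuc i))

  sumList : {A : Set} → List A → (A → Carrier) → Carrier
  sumList xs f = foldr (λ a acc → f a ⊕ acc) 0# xs

{-# OPTIONS --safe #-}
-- Let W_z be the matrix indexed by paths to (x, y) whose entry at (P, Q) is
-- z^(common east steps) if P lies weakly above Q, and 0 otherwise.  The
-- generating function is the (T, B) entry of W_{z₀} W_{z₁} ⋯ W_{z_k}, so it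
-- suffices that W_a and W_b commute, which is the case k = 1.  For that, let
-- f u v be the sum over the completions of a middle path that is currently u
-- steps below T and v steps above B, and let g be f with a and b exchanged.
-- The relation (1 + (1 - a) X) f = (1 + (1 - b) X) g, where
-- X f u v = f (u + 1) (v - 1), is stable under prepending any pair of steps
-- to T and B; at v = 0 it says f = g.
module Submission where

open import Defs
open import Data.Nat as ℕ using (ℕ; zero; suc; _≤_; _≤ᵇ_; _≡ᵇ_; s≤s)
open import Data.Nat.Properties using (+-suc; suc-injective; m≤n+m; ≤⇒≤ᵇ; ≡⇒≡ᵇ; ≡ᵇ⇒≡)
open import Data.Bool using (Bool; true; false; _∧_; if_then_else_) renaming (T to IsTrue)
open import Data.Bool.Properties using (T-≡; T-∧)
open import Data.List using (List; []; _∷_; _++_; map; concatMap; filterᵇ; tabulate)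
open import Data.List.Relation.Binary.Permutation.Propositional using (_↭_; refl; prep; swap; trans; ↭-sym; ↭-trans)
open import Data.List.Relation.Binary.Permutation.Propositional.Properties using (++-commutativeMonoid; ↭-length)
open import Data.Vec using (Vec; _∷_)
open import Data.Fin using (Fin) renaming (zero to fzero; suc to fsuc)
open import Data.Fin.Permutation using (Permutation′; _⟨$⟩ʳ_; _⟨$⟩ˡ_; inverseˡ; flip)
open import Data.Product using (_×_; _,_; proj₁; proj₂)
open import Data.Sum using (_⊎_; inj₁; inj₂)
open import Data.Empty using (⊥-elim)
open import Function using (_∘_; Equivalence)
open import Relation.Binary.PropositionalEquality as ≡ using (_≡_; _≢_)
open import Algebra.Bundles using (CommutativeSemiring)
open import Level using (Level)
import Algebra.Properties.CommutativeMonoid.Sum as MonoidSum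
import Algebra.Properties.CommutativeSemigroup as SemigroupProperties
import Algebra.Solver.Ring.NaturalCoefficients.Default as SemiringSolver
import Relation.Binary.Reasoning.Setoid as SetoidReasoning

-- The relation of lying weakly above, with a diagonal offset.

-- `Above u P Q`: P, starting u diagonal steps north-west of Q, stays weakly above Q and
-- ends at the same point.
data Above : ℕ → Path → Path → Set where
  []  : Above 0 [] []
  _NN : ∀ {u P Q} → Above u P Q → Above u (N ∷ P) (N ∷ Q)
  _NE : ∀ {u P Q} → Above (suc u) P Q → Above u (N ∷ P) (E ∷ Q)
  _EN : ∀ {u P Q} → Above u P Q → Above (suc u) (E ∷ P) (N ∷ Q)
  _EE : ∀ {u P Q} → Above u P Q → Above u (E ∷ P) (E ∷ Q)

above-refl : ∀ P → Above 0 P P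
above-refl []      = []
above-refl (N ∷ P) = above-refl P NN
above-refl (E ∷ P) = above-refl P EE

above-subst : ∀ {u v P Q} → u ≡ v → Above u P Q → Above v P Q
above-subst ≡.refl p = p

-- Offsets add along the middle path Q. Where the step of Q differs from those of both P and R, one
-- unit passes between u and v and the sum is unchanged.
above-trans : ∀ {u v P Q R} → Above u P Q → Above v Q R → Above (u ℕ.+ v) P R
above-trans []             []     = []
above-trans (p NN)         (q NN) = above-trans p q NN
above-trans {u} {v} (p NN) (q NE) = above-subst (+-suc u v) (above-trans p q) NE
above-trans {u} {suc v} (p NE) (q EN) = above-subst (≡.sym (+-suc u v)) (above-trans p q) NN
above-trans (p NE)         (q EE) = above-trans p q NE
above-trans (p EN)         (q NN) = above-trans p q EN
above-trans {suc u} {v} (p EN) (q NE) = above-subst (+-suc u v) (above-trans p q) EE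
above-trans {u} {suc v} (p EE) (q EN) = above-subst (≡.sym (+-suc u v)) (above-trans p q EN)
above-trans (p EE)         (q EE) = above-trans p q EE

-- P starts u diagonal steps north-west of Q and both end at the same point, so Q must make up u
-- north steps and P must make up u east steps.
above-countN : ∀ {u P Q} → Above u P Q → u ℕ.+ countN P ≡ countN Q
above-countN []         = ≡.refl
above-countN {u} (p NN) = ≡.trans (+-suc u _) (≡.cong suc (above-countN p))
above-countN {u} (p NE) = ≡.trans (+-suc u _) (above-countN p)
above-countN (p EN)     = ≡.cong suc (above-countN p)
above-countN (p EE)     = above-countN p

above-countE : ∀ {u P Q} → Above u P Q → countE P ≡ u ℕ.+ countE Q
above-countE []         = ≡.refl
above-countE (p NN)     = above-countE p
above-countE {u} (p NE) = ≡.trans (above-countE p) (≡.sym (+-suc u _))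
above-countE (p EN)     = ≡.cong suc (above-countE p)
above-countE {u} (p EE) = ≡.trans (≡.cong suc (above-countE p)) (≡.sym (+-suc u _))

above-endsAt : ∀ {x y P Q} → Above 0 P Q → endsAtᵇ x y P ≡ endsAtᵇ x y Q
above-endsAt {x} {y} p =
  ≡.cong₂ (λ i j → (i ≡ᵇ x) ∧ (j ≡ᵇ y)) (above-countE p) (above-countN p)

-- Agreement of `Above` with the Boolean test.

toTrue : ∀ {b} → IsTrue b → b ≡ true
toTrue = Equivalence.to T-≡

fromTrue : ∀ {b} → b ≡ true → IsTrue b
fromTrue = Equivalence.from T-≡

p≤ᵇu+p : ∀ u p → (p ≤ᵇ u ℕ.+ p) ≡ true
p≤ᵇu+p u p = toTrue (≤⇒≤ᵇ (m≤n+m p u))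

1+p≰ᵇp : ∀ p → (suc p ≤ᵇ p) ≡ false
1+p≰ᵇp zero    = ≡.refl
1+p≰ᵇp (suc p) = 1+p≰ᵇp p

p≡ᵇp : ∀ p → (p ≡ᵇ p) ≡ true
p≡ᵇp p = toTrue (≡⇒≡ᵇ p p ≡.refl)

1+u+p≢ᵇp : ∀ u p → (suc u ℕ.+ p ≡ᵇ p) ≡ false
1+u+p≢ᵇp u zero    = ≡.refl
1+u+p≢ᵇp u (suc p) = ≡.trans (≡.cong (_≡ᵇ p) (+-suc u p)) (1+u+p≢ᵇp u p)

-- The two prefix counts kept by `aboveAux` differ by the offset, hence the form `u + p` and `p`;
-- the rewrites restore this form after a step.
above-aboveAux : ∀ {u P Q} p → Above u P Q → aboveAux (u ℕ.+ p) p P Q ≡ true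
above-aboveAux p []         = ≡.refl
above-aboveAux {u} p (a NN) rewrite ≡.sym (+-suc u p) | p≤ᵇu+p u (suc p) = above-aboveAux (suc p) a
above-aboveAux {u} p (a NE) rewrite p≤ᵇu+p (suc u) p = above-aboveAux p a
above-aboveAux {suc u} p (a EN) rewrite ≡.sym (+-suc u p) | p≤ᵇu+p u (suc p) = above-aboveAux (suc p) a
above-aboveAux {u} p (a EE) rewrite p≤ᵇu+p u p = above-aboveAux p a

-- `aboveAux` compares the paths after each step but does not test that they meet at the end. The
-- equation of N-counts supplies this: at two empty paths it leaves only `u = 0`.
aboveAux-above : ∀ u p P Q → u ℕ.+ countN P ≡ countN Q →
                 aboveAux (u ℕ.+ p) p P Q ≡ true → Above u P Q
aboveAux-above zero    p []      []      eq t = []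
aboveAux-above u       p (N ∷ P) (N ∷ Q) eq t
  rewrite ≡.sym (+-suc u p) | p≤ᵇu+p u (suc p)
  = aboveAux-above u (suc p) P Q (suc-injective (≡.trans (≡.sym (+-suc u _)) eq)) t NN
aboveAux-above u       p (N ∷ P) (E ∷ Q) eq t
  rewrite p≤ᵇu+p (suc u) p
  = aboveAux-above (suc u) p P Q (≡.trans (≡.sym (+-suc u _)) eq) t NE
aboveAux-above zero    p (E ∷ P) (N ∷ Q) eq t rewrite 1+p≰ᵇp p with () ← t
aboveAux-above (suc u) p (E ∷ P) (N ∷ Q) eq t
  rewrite ≡.sym (+-suc u p) | p≤ᵇu+p u (suc p)
  = aboveAux-above u (suc p) P Q (suc-injective eq) t EN
aboveAux-above u       p (E ∷ P) (E ∷ Q) eq t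
  rewrite p≤ᵇu+p u p
  = aboveAux-above u p P Q eq t EE

endsAt-countN : ∀ {x y} P → endsAtᵇ x y P ≡ true → countN P ≡ y
endsAt-countN P e = ≡ᵇ⇒≡ _ _ (proj₂ (Equivalence.to T-∧ (fromTrue e)))

weaklyAbove-above : ∀ {x y P Q} → endsAtᵇ x y P ≡ true → endsAtᵇ x y Q ≡ true →
                    weaklyAboveᵇ P Q ≡ true → Above 0 P Q
weaklyAbove-above {P = P} {Q} eP eQ =
  aboveAux-above 0 0 P Q (≡.trans (endsAt-countN P eP) (≡.sym (endsAt-countN Q eQ)))

-- Lists up to permutation form a commutative monoid under `_++_`, in which `tabulate f` is a sum of
-- singletons; such a sum is invariant under permuting its indices.
tabulate-permute : ∀ {a} {A : Set a} {n} (f : Fin n → A) (π : Permutation′ n) →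
                   tabulate f ↭ tabulate (f ∘ (π ⟨$⟩ʳ_))
tabulate-permute {A = A} f π =
  ↭-trans (sum-tabulate f) (↭-trans (sum-permute (λ i → f i ∷ []) π) (↭-sym (sum-tabulate _)))
  where
  open MonoidSum (++-commutativeMonoid {A = A}) using (sum; sum-permute)
  sum-tabulate : ∀ {n} (g : Fin n → A) → tabulate g ↭ sum (λ i → g i ∷ [])
  sum-tabulate {zero}  g = refl
  sum-tabulate {suc n} g = prep _ (sum-tabulate (g ∘ fsuc))

module Weights {c ℓ : Level} (R : CommutativeSemiring c ℓ) where
  open CommutativeSemiring R hiding (zero) renaming (refl to ≈-refl; sym to ≈-sym; trans to ≈-trans)
  open SemigroupProperties *-commutativeSemigroup using (x∙yz≈y∙xz)
  open SemiringSolver R using (solve; _:=_; _:+_; _:*_)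
  open SetoidReasoning setoid

  -- Finite sums in a commutative semiring.

  private variable
    A C : Set

  ∑ : List A → (A → Carrier) → Carrier
  ∑ = sumList R

  ∑-cong : ∀ (xs : List A) {f g} → (∀ x → f x ≈ g x) → ∑ xs f ≈ ∑ xs g
  ∑-cong []       eq = ≈-refl
  ∑-cong (x ∷ xs) eq = +-cong (eq x) (∑-cong xs eq)

  ∑-zero : ∀ (xs : List A) {f} → (∀ x → f x ≈ 0#) → ∑ xs f ≈ 0#
  ∑-zero []       eq = ≈-refl
  ∑-zero (x ∷ xs) eq = ≈-trans (+-cong (eq x) (∑-zero xs eq)) (+-identityˡ 0#)

  -- Equality with `0#` need not be decidable, so a support statement is a disjunction: each term
  -- either vanishes provably or yields a proof of X.
  ∑-support : ∀ {p} {X : Set p} (xs : List A) {f} → (∀ x → f x ≈ 0# ⊎ X) → ∑ xs f ≈ 0# ⊎ X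
  ∑-support []       s = inj₁ ≈-refl
  ∑-support (x ∷ xs) s with s x | ∑-support xs s
  ... | inj₂ p  | _       = inj₂ p
  ... | inj₁ _  | inj₂ p  = inj₂ p
  ... | inj₁ eq | inj₁ e  = inj₁ (≈-trans (+-cong eq e) (+-identityˡ 0#))

  ∑-scaleˡ : ∀ a (xs : List A) f → ∑ xs (λ x → a * f x) ≈ a * ∑ xs f
  ∑-scaleˡ a []       f = ≈-sym (zeroʳ a)
  ∑-scaleˡ a (x ∷ xs) f = ≈-trans (+-congˡ (∑-scaleˡ a xs f)) (≈-sym (distribˡ a _ _))

  ∑-scaleʳ : ∀ a (xs : List A) f → ∑ xs (λ x → f x * a) ≈ ∑ xs f * a
  ∑-scaleʳ a xs f = ≈-trans (∑-cong xs (λ x → *-comm (f x) a)) (≈-trans (∑-scaleˡ a xs f) (*-comm a _))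

  ∑-+ : ∀ (xs : List A) f g → ∑ xs (λ x → f x + g x) ≈ ∑ xs f + ∑ xs g
  ∑-+ []       f g = ≈-sym (+-identityˡ 0#)
  ∑-+ (x ∷ xs) f g = ≈-trans (+-congˡ (∑-+ xs f g))
    (solve 4 (λ p q r s → (p :+ q) :+ (r :+ s) := (p :+ r) :+ (q :+ s)) ≈-refl (f x) (g x) _ _)

  ∑-swap : ∀ (xs : List A) (ys : List C) (f : A → C → Carrier) →
           ∑ xs (λ x → ∑ ys (f x)) ≈ ∑ ys (λ y → ∑ xs (λ x → f x y))
  ∑-swap []       ys f = ≈-sym (∑-zero ys (λ _ → ≈-refl))
  ∑-swap (x ∷ xs) ys f = ≈-trans (+-congˡ (∑-swap xs ys f)) (≈-sym (∑-+ ys (f x) _))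

  ∑-++ : ∀ (xs ys : List A) f → ∑ (xs ++ ys) f ≈ ∑ xs f + ∑ ys f
  ∑-++ []       ys f = ≈-sym (+-identityˡ _)
  ∑-++ (x ∷ xs) ys f = ≈-trans (+-congˡ (∑-++ xs ys f)) (≈-sym (+-assoc _ _ _))

  ∑-concatMap : ∀ (g : C → List A) xs f → ∑ (concatMap g xs) f ≈ ∑ xs (λ x → ∑ (g x) f)
  ∑-concatMap g []       f = ≈-refl
  ∑-concatMap g (x ∷ xs) f = ≈-trans (∑-++ (g x) _ f) (+-congˡ (∑-concatMap g xs f))

  ∑-map : ∀ (g : C → A) xs f → ∑ (map g xs) f ≈ ∑ xs (f ∘ g)
  ∑-map g []       f = ≈-refl
  ∑-map g (x ∷ xs) f = +-congˡ (∑-map g xs f)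

  ∑-filter : ∀ (p : A → Bool) xs f → ∑ (filterᵇ p xs) f ≈ ∑ xs (λ x → if p x then f x else 0#)
  ∑-filter p []       f = ≈-refl
  ∑-filter p (x ∷ xs) f with p x
  ... | true  = +-congˡ (∑-filter p xs f)
  ... | false = ≈-trans (∑-filter p xs f) (≈-sym (+-identityˡ _))

  ∑-words : ∀ n f → ∑ (words (suc n)) f ≈ ∑ (words n) (f ∘ (N ∷_)) + ∑ (words n) (f ∘ (E ∷_))
  ∑-words n f = begin
    ∑ (words (suc n)) f                            ≈⟨ ∑-concatMap _ (words n) f ⟩
    ∑ (words n) (λ w → f (N ∷ w) + (f (E ∷ w) + 0#)) ≈⟨ ∑-cong (words n) (λ w → +-congˡ (+-identityʳ _)) ⟩
    ∑ (words n) (λ w → f (N ∷ w) + f (E ∷ w))      ≈⟨ ∑-+ (words n) _ _ ⟩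
    _                                              ∎

  -- The entries of the matrix W_z.

  -- z to the number of east steps common to P and Q if `Above u P Q`, and 0 otherwise.
  weight : Carrier → ℕ → Path → Path → Carrier
  weight z u       []      (_ ∷ _) = 0#
  weight z u       (_ ∷ _) []      = 0#
  weight z zero    []      []      = 1#
  weight z (suc u) []      []      = 0#
  weight z u       (N ∷ P) (N ∷ Q) = weight z u P Q
  weight z u       (N ∷ P) (E ∷ Q) = weight z (suc u) P Q
  weight z zero    (E ∷ P) (N ∷ Q) = 0#
  weight z (suc u) (E ∷ P) (N ∷ Q) = weight z u P Q
  weight z zero    (E ∷ P) (E ∷ Q) = z * weight z zero P Q
  weight z (suc u) (E ∷ P) (E ∷ Q) = weight z (suc u) P Q

  weight-support : ∀ z u P Q → weight z u P Q ≈ 0# ⊎ Above u P Q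
  weight-support z zero    []      []      = inj₂ []
  weight-support z (suc u) []      []      = inj₁ ≈-refl
  weight-support z u       []      (_ ∷ _) = inj₁ ≈-refl
  weight-support z u       (_ ∷ _) []      = inj₁ ≈-refl
  weight-support z u       (N ∷ P) (N ∷ Q) with weight-support z u P Q
  ... | inj₁ eq = inj₁ eq
  ... | inj₂ a  = inj₂ (a NN)
  weight-support z u       (N ∷ P) (E ∷ Q) with weight-support z (suc u) P Q
  ... | inj₁ eq = inj₁ eq
  ... | inj₂ a  = inj₂ (a NE)
  weight-support z zero    (E ∷ P) (N ∷ Q) = inj₁ ≈-refl
  weight-support z (suc u) (E ∷ P) (N ∷ Q) with weight-support z u P Q
  ... | inj₁ eq = inj₁ eq
  ... | inj₂ a  = inj₂ (a EN)
  weight-support z zero    (E ∷ P) (E ∷ Q) with weight-support z zero P Q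
  ... | inj₁ eq = inj₁ (≈-trans (*-congˡ eq) (zeroʳ z))
  ... | inj₂ a  = inj₂ (a EE)
  weight-support z (suc u) (E ∷ P) (E ∷ Q) with weight-support z (suc u) P Q
  ... | inj₁ eq = inj₁ eq
  ... | inj₂ a  = inj₂ (a EE)

  guardedPow : Carrier → ℕ → ℕ → Path → Path → Carrier
  guardedPow z a b P Q = if aboveAux a b P Q then pow R z (commonEAux a b P Q) else 0#

  -- Common east steps are those taken by both paths at offset 0. The equation of N-counts excludes
  -- a positive offset at two empty paths, where `guardedPow` is `1#` and `weight` is `0#`.
  guardedPow≈weight : ∀ z u p P Q → u ℕ.+ countN P ≡ countN Q →
                      guardedPow z (u ℕ.+ p) p P Q ≈ weight z u P Q
  guardedPow≈weight z zero    p []      []      eq = ≈-refl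
  guardedPow≈weight z u       p []      (_ ∷ _) eq = ≈-refl
  guardedPow≈weight z u       p (_ ∷ _) []      eq = ≈-refl
  guardedPow≈weight z u       p (N ∷ P) (N ∷ Q) eq
    rewrite ≡.sym (+-suc u p) | p≤ᵇu+p u (suc p)
    = guardedPow≈weight z u (suc p) P Q (suc-injective (≡.trans (≡.sym (+-suc u _)) eq))
  guardedPow≈weight z u       p (N ∷ P) (E ∷ Q) eq
    rewrite p≤ᵇu+p (suc u) p
    = guardedPow≈weight z (suc u) p P Q (≡.trans (≡.sym (+-suc u _)) eq)
  guardedPow≈weight z zero    p (E ∷ P) (N ∷ Q) eq rewrite 1+p≰ᵇp p = ≈-refl
  guardedPow≈weight z (suc u) p (E ∷ P) (N ∷ Q) eq
    rewrite ≡.sym (+-suc u p) | p≤ᵇu+p u (suc p)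
    = guardedPow≈weight z u (suc p) P Q (suc-injective eq)
  guardedPow≈weight z zero    p (E ∷ P) (E ∷ Q) eq
    rewrite p≤ᵇu+p 0 p | p≡ᵇp p
    = ≈-trans (factor (aboveAux p p P Q)) (*-congˡ (guardedPow≈weight z zero p P Q eq))
    where
    factor : ∀ b {x} → (if b then z * x else 0#) ≈ z * (if b then x else 0#)
    factor true  = ≈-refl
    factor false = ≈-sym (zeroʳ z)
  guardedPow≈weight z (suc u) p (E ∷ P) (E ∷ Q) eq
    rewrite p≤ᵇu+p (suc u) p | 1+u+p≢ᵇp u p
    = guardedPow≈weight z (suc u) p P Q eq

  -- Generating function of the middle path, by recursion on T and B.

  Profile : Set c
  Profile = ℕ → ℕ → Carrier

  -- The middle path's first step N contributes the first term and E the second; a term is absent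
  -- where that step would cross T or B. The factors `a` and `b` mark an east step shared with T and
  -- with B.
  step : Carrier → Carrier → Step → Step → Profile → Profile
  step a b N N f u       zero    = f u 0
  step a b N N f u       (suc v) = f u (suc v) + f (suc u) v
  step a b N E f u       zero    = f u 1 + b * f (suc u) 0
  step a b N E f u       (suc v) = f u (suc (suc v)) + f (suc u) (suc v)
  step a b E N f zero    zero    = 0#
  step a b E N f zero    (suc v) = a * f 0 v
  step a b E N f (suc u) zero    = f u 0
  step a b E N f (suc u) (suc v) = f u (suc v) + f (suc u) v
  step a b E E f zero    zero    = a * (b * f 0 0)
  step a b E E f zero    (suc v) = a * f 0 (suc v)
  step a b E E f (suc u) zero    = f u 1 + b * f (suc u) 0
  step a b E E f (suc u) (suc v) = f u (suc (suc v)) + f (suc u) (suc v)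

  leaf : Profile
  leaf zero    zero    = 1#
  leaf zero    (suc v) = 0#
  leaf (suc u) v       = 0#

  profile : Carrier → Carrier → ℕ → Path → Path → Profile
  profile a b zero    []      []      = leaf
  profile a b (suc n) (s ∷ T) (r ∷ B) = step a b s r (profile a b n T B)
  profile a b _       _       _       = λ _ _ → 0#

  -- Splitting the sum by the first step of the middle path reproduces the clauses of `step`;
  -- `noneˡ` and `noneʳ` dispose of steps that cross T and B.
  ∑-weight≈profile : ∀ a b n T B u v →
    ∑ (words n) (λ P → weight a u T P * weight b v P B) ≈ profile a b n T B u v
  ∑-weight≈profile a b zero [] [] zero zero = ≈-trans (+-identityʳ _) (*-identityˡ 1#)
  ∑-weight≈profile a b zero [] [] zero (suc v) = ≈-trans (+-identityʳ _) (zeroʳ _)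
  ∑-weight≈profile a b zero [] [] (suc u) v = ≈-trans (+-identityʳ _) (zeroˡ _)
  ∑-weight≈profile a b zero [] (_ ∷ _) u v = ≈-trans (+-identityʳ _) (zeroʳ _)
  ∑-weight≈profile a b zero (_ ∷ _) B u v = ≈-trans (+-identityʳ _) (zeroˡ _)
  ∑-weight≈profile a b (suc n) [] B u v =
    ≈-trans (∑-words n _) (≈-trans (+-cong (∑-zero (words n) λ _ → zeroˡ _) (∑-zero (words n) λ _ → zeroˡ _)) (+-identityˡ 0#))
  ∑-weight≈profile a b (suc n) (_ ∷ _) [] u v =
    ≈-trans (∑-words n _) (≈-trans (+-cong (∑-zero (words n) λ _ → zeroʳ _) (∑-zero (words n) λ _ → zeroʳ _)) (+-identityˡ 0#))
  ∑-weight≈profile a b (suc n) (s ∷ T) (r ∷ B) u v = ≈-trans (∑-words n _) (go s r u v)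
    where
    f : Profile
    f = profile a b n T B
    ih : ∀ u v → ∑ (words n) (λ P → weight a u T P * weight b v P B) ≈ f u v
    ih = ∑-weight≈profile a b n T B
    ih-scaleˡ : ∀ u v → ∑ (words n) (λ P → (a * weight a u T P) * weight b v P B) ≈ a * f u v
    ih-scaleˡ u v = begin
      ∑ (words n) (λ P → (a * weight a u T P) * weight b v P B) ≈⟨ ∑-cong (words n) (λ _ → *-assoc _ _ _) ⟩
      ∑ (words n) (λ P → a * (weight a u T P * weight b v P B)) ≈⟨ ∑-scaleˡ a (words n) _ ⟩
      a * ∑ (words n) (λ P → weight a u T P * weight b v P B)   ≈⟨ *-congˡ (ih u v) ⟩
      a * f u v ∎
    ih-scaleʳ : ∀ u v → ∑ (words n) (λ P → weight a u T P * (b * weight b v P B)) ≈ b * f u v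
    ih-scaleʳ u v = begin
      ∑ (words n) (λ P → weight a u T P * (b * weight b v P B)) ≈⟨ ∑-cong (words n) (λ _ → x∙yz≈y∙xz _ _ _) ⟩
      ∑ (words n) (λ P → b * (weight a u T P * weight b v P B)) ≈⟨ ∑-scaleˡ b (words n) _ ⟩
      b * ∑ (words n) (λ P → weight a u T P * weight b v P B)   ≈⟨ *-congˡ (ih u v) ⟩
      b * f u v ∎
    ih-scale₂ : ∀ u v → ∑ (words n) (λ P → (a * weight a u T P) * (b * weight b v P B)) ≈ a * (b * f u v)
    ih-scale₂ u v = begin
      ∑ (words n) (λ P → (a * weight a u T P) * (b * weight b v P B)) ≈⟨ ∑-cong (words n) (λ _ → *-assoc _ _ _) ⟩
      ∑ (words n) (λ P → a * (weight a u T P * (b * weight b v P B))) ≈⟨ ∑-scaleˡ a (words n) _ ⟩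
      a * ∑ (words n) (λ P → weight a u T P * (b * weight b v P B))   ≈⟨ *-congˡ (ih-scaleʳ u v) ⟩
      a * (b * f u v) ∎
    noneˡ : ∀ {g : Path → Carrier} → ∑ (words n) (λ P → 0# * g P) ≈ 0#
    noneˡ = ∑-zero (words n) (λ _ → zeroˡ _)
    noneʳ : ∀ {g : Path → Carrier} → ∑ (words n) (λ P → g P * 0#) ≈ 0#
    noneʳ = ∑-zero (words n) (λ _ → zeroʳ _)
    go : ∀ s r u v →
      ∑ (words n) (λ P → weight a u (s ∷ T) (N ∷ P) * weight b v (N ∷ P) (r ∷ B)) +
      ∑ (words n) (λ P → weight a u (s ∷ T) (E ∷ P) * weight b v (E ∷ P) (r ∷ B))
      ≈ step a b s r f u v
    go N N u       zero    = ≈-trans (+-cong (ih u 0) noneʳ) (+-identityʳ _)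
    go N N u       (suc v) = +-cong (ih u (suc v)) (ih (suc u) v)
    go N E u       zero    = +-cong (ih u 1) (ih-scaleʳ (suc u) 0)
    go N E u       (suc v) = +-cong (ih u (suc (suc v))) (ih (suc u) (suc v))
    go E N zero    zero    = ≈-trans (+-cong noneˡ noneʳ) (+-identityˡ _)
    go E N zero    (suc v) = ≈-trans (+-cong noneˡ (ih-scaleˡ 0 v)) (+-identityˡ _)
    go E N (suc u) zero    = ≈-trans (+-cong (ih u 0) noneʳ) (+-identityʳ _)
    go E N (suc u) (suc v) = +-cong (ih u (suc v)) (ih (suc u) v)
    go E E zero    zero    = ≈-trans (+-cong noneˡ (ih-scale₂ 0 0)) (+-identityˡ _)
    go E E zero    (suc v) = ≈-trans (+-cong noneˡ (ih-scaleˡ 0 (suc v))) (+-identityˡ _)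
    go E E (suc u) zero    = +-cong (ih u 1) (ih-scaleʳ (suc u) 0)
    go E E (suc u) (suc v) = +-cong (ih u (suc (suc v))) (ih (suc u) (suc v))

  -- The relation exchanging a and b.

  edge : Carrier → Profile → Profile → ℕ → Carrier
  edge b f g u = f u 1 + b * g (suc u) 0

  -- One side of the rearranged relation at `(u, v + 2)`, as `edge` is one side at `(u, 1)`.
  interior : Carrier → Profile → Profile → ℕ → ℕ → Carrier
  interior b f g u v = (f u (suc (suc v)) + f (suc u) (suc v)) + b * g (suc u) (suc v)

  -- The relation (1 + (1 - a) X) f = (1 + (1 - b) X) g, rearranged to avoid
  -- subtraction.  At v = 1 a common term f (u + 1) 0 = g (u + 1) 0 is dropped
  -- from both sides, since addition need not be cancellative.
  record Swappable (a b : Carrier) (f g : Profile) : Set ℓ where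
    field
      bottom-≈   : ∀ u → f u 0 ≈ g u 0
      edge-≈     : ∀ u → edge b f g u ≈ edge a g f u
      interior-≈ : ∀ u v → interior b f g u v ≈ interior a g f u v

  conjugate : ∀ {l m m′ l′} → l ≈ m → l′ ≈ m′ → m ≈ m′ → l ≈ l′
  conjugate p q r = ≈-trans p (≈-trans r (≈-sym q))

  -- Away from the boundary each `step` is `1 + X` up to a shift of indices and so commutes with X:
  -- a new entry of the relation is a sum of two neighbouring old ones. The rest is the boundary at
  -- small u and v.
  step-swappable : ∀ {a b f g} s r → Swappable a b f g →
                   Swappable a b (step a b s r f) (step b a s r g)
  step-swappable {a} {b} {f} {g} s r fg = record
    { bottom-≈ = bottom′ s r ; edge-≈ = edge′ s r ; interior-≈ = interior′ s r }
    where
    open Swappable fg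
    -- These identities regroup a new entry of the relation into old entries and a remainder; each
    -- is applied with `b` on the left side and `a` on the right.
    id₁ : ∀ b x y z → (x + y) + b * z ≈ (x + b * z) + y
    id₁ = solve 4 (λ b x y z → (x :+ y) :+ b :* z := (x :+ b :* z) :+ y) ≈-refl
    id₂ : ∀ b p q r q′ r′ → ((p + q) + (q + r)) + b * (q′ + r′) ≈ ((p + q) + b * q′) + ((q + b * r′) + r)
    id₂ = solve 6 (λ b p q r q′ r′ → ((p :+ q) :+ (q :+ r)) :+ b :* (q′ :+ r′) := ((p :+ q) :+ b :* q′) :+ ((q :+ b :* r′) :+ r)) ≈-refl
    id₃ : ∀ b p q r q′ r′ → ((p + q) + (q + r)) + b * (q′ + r′) ≈ ((p + q) + b * q′) + ((q + r) + b * r′)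
    id₃ = solve 6 (λ b p q r q′ r′ → ((p :+ q) :+ (q :+ r)) :+ b :* (q′ :+ r′) := ((p :+ q) :+ b :* q′) :+ ((q :+ r) :+ b :* r′)) ≈-refl
    id₄ : ∀ b c x y → x + b * (y + c) ≈ (x + b * y) + b * c
    id₄ = solve 4 (λ b c x y → x :+ b :* (y :+ c) := (x :+ b :* y) :+ b :* c) ≈-refl
    id₅ : ∀ b x p q p′ q′ → (x + (p + q)) + b * (p′ + q′) ≈ ((p + q) + b * q′) + (x + b * p′)
    id₅ = solve 6 (λ b x p q p′ q′ → (x :+ (p :+ q)) :+ b :* (p′ :+ q′) := ((p :+ q) :+ b :* q′) :+ (x :+ b :* p′)) ≈-refl

    edge-scaled : ∀ u → f u 1 + b * f (suc u) 0 ≈ g u 1 + a * g (suc u) 0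
    edge-scaled u = conjugate (+-congˡ (*-congˡ (bottom-≈ (suc u)))) (+-congˡ (*-congˡ (≈-sym (bottom-≈ (suc u))))) (edge-≈ u)

    scaled-bottom : ∀ u → b * (a * g u 0) ≈ a * (b * f u 0)
    scaled-bottom u = ≈-trans (x∙yz≈y∙xz _ _ _) (*-congˡ (*-congˡ (≈-sym (bottom-≈ u))))

    -- This restores the common term dropped from the relation at `v = 1`.
    edge+bottom : ∀ u → (f u 1 + f (suc u) 0) + b * g (suc u) 0 ≈ (g u 1 + g (suc u) 0) + a * f (suc u) 0
    edge+bottom u = conjugate (id₁ b _ _ _) (id₁ a _ _ _) (+-cong (edge-≈ u) (bottom-≈ (suc u)))

    interior+scaled : ∀ u →
      (f u 2 + f (suc u) 1) + b * (g (suc u) 1 + a * g (suc (suc u)) 0) ≈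
      (g u 2 + g (suc u) 1) + a * (f (suc u) 1 + b * f (suc (suc u)) 0)
    interior+scaled u = conjugate (id₄ b _ _ _) (id₄ a _ _ _) (+-cong (interior-≈ u 0) (scaled-bottom (suc (suc u))))

    interior+edge : ∀ u →
      ((f u 2 + f (suc u) 1) + (f (suc u) 1 + f (suc (suc u)) 0)) + b * (g (suc u) 1 + g (suc (suc u)) 0) ≈
      ((g u 2 + g (suc u) 1) + (g (suc u) 1 + g (suc (suc u)) 0)) + a * (f (suc u) 1 + f (suc (suc u)) 0)
    interior+edge u = conjugate (id₂ b _ _ _ _ _) (id₂ a _ _ _ _ _)
      (+-cong (interior-≈ u 0) (+-cong (edge-≈ (suc u)) (bottom-≈ (suc (suc u)))))

    interior+interior : ∀ u v →
      ((f u (3 ℕ.+ v) + f (1 ℕ.+ u) (2 ℕ.+ v)) + (f (1 ℕ.+ u) (2 ℕ.+ v) + f (2 ℕ.+ u) (1 ℕ.+ v)))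
        + b * (g (1 ℕ.+ u) (2 ℕ.+ v) + g (2 ℕ.+ u) (1 ℕ.+ v)) ≈
      ((g u (3 ℕ.+ v) + g (1 ℕ.+ u) (2 ℕ.+ v)) + (g (1 ℕ.+ u) (2 ℕ.+ v) + g (2 ℕ.+ u) (1 ℕ.+ v)))
        + a * (f (1 ℕ.+ u) (2 ℕ.+ v) + f (2 ℕ.+ u) (1 ℕ.+ v))
    interior+interior u v = conjugate (id₃ b _ _ _ _ _) (id₃ a _ _ _ _ _)
      (+-cong (interior-≈ u (suc v)) (interior-≈ (suc u) v))

    -- When T starts with E and `u = 0`, the middle path cannot start with N. Beyond an old interior
    -- entry this leaves `a * f 0 (2 + v)` plus `b * g 0 (2 + v)`, which is symmetric under the
    -- exchange.
    interior+top : ∀ v →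
      (a * f 0 (2 ℕ.+ v) + (f 0 (2 ℕ.+ v) + f 1 (1 ℕ.+ v))) + b * (g 0 (2 ℕ.+ v) + g 1 (1 ℕ.+ v)) ≈
      (b * g 0 (2 ℕ.+ v) + (g 0 (2 ℕ.+ v) + g 1 (1 ℕ.+ v))) + a * (f 0 (2 ℕ.+ v) + f 1 (1 ℕ.+ v))
    interior+top v = conjugate (id₅ b _ _ _ _ _) (id₅ a _ _ _ _ _) (+-cong (interior-≈ 0 v) (+-comm _ _))

    bottom′ : ∀ s r u → step a b s r f u 0 ≈ step b a s r g u 0
    bottom′ N N u       = bottom-≈ u
    bottom′ N E u       = edge-scaled u
    bottom′ E N zero    = ≈-refl
    bottom′ E N (suc u) = bottom-≈ u
    bottom′ E E zero    = ≈-trans (x∙yz≈y∙xz _ _ _) (*-congˡ (*-congˡ (bottom-≈ 0)))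
    bottom′ E E (suc u) = edge-scaled u

    edge′ : ∀ s r u → edge b (step a b s r f) (step b a s r g) u ≈ edge a (step b a s r g) (step a b s r f) u
    edge′ N N u       = edge+bottom u
    edge′ N E u       = interior+scaled u
    edge′ E N zero    = +-comm _ _
    edge′ E N (suc u) = edge+bottom u
    edge′ E E zero    = conjugate (id₄ b _ _ _) (id₄ a _ _ _) (+-cong (+-comm _ _) (scaled-bottom 1))
    edge′ E E (suc u) = interior+scaled u

    interior′ : ∀ s r u v → interior b (step a b s r f) (step b a s r g) u v ≈ interior a (step b a s r g) (step a b s r f) u v
    interior′ N N u       zero    = interior+edge u
    interior′ N N u       (suc v) = interior+interior u v
    interior′ N E u       v       = interior+interior u v
    -- The remainder is `a * f 0 1` plus `b * g 0 1`, in either order; the old entry is the one at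
    -- `v = 1` with its common term restored.
    interior′ E N zero    zero    = conjugate (id₅ b _ _ _ _ _) (id₅ a _ _ _ _ _) (+-cong (edge+bottom 0) (+-comm _ _))
    interior′ E N zero    (suc v) = interior+top v
    interior′ E N (suc u) zero    = interior+edge u
    interior′ E N (suc u) (suc v) = interior+interior u v
    interior′ E E zero    v       = interior+top v
    interior′ E E (suc u) v       = interior+interior u v

  leaf-swappable : ∀ {a b} → Swappable a b leaf leaf
  leaf-swappable = record
    { bottom-≈   = λ _ → ≈-refl
    ; edge-≈     = λ { zero → vanish ; (suc _) → vanish }
    ; interior-≈ = λ { zero _ → vanish ; (suc _) _ → vanish }
    }
    where
    vanish : ∀ {a b x} → x + b * 0# ≈ x + a * 0#
    vanish {a} {b} = +-congˡ (≈-trans (zeroʳ b) (≈-sym (zeroʳ a)))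

  zero-swappable : ∀ {a b} → Swappable a b (λ _ _ → 0#) (λ _ _ → 0#)
  zero-swappable {a} {b} = record
    { bottom-≈   = λ _ → ≈-refl
    ; edge-≈     = λ _ → vanish
    ; interior-≈ = λ _ _ → vanish
    }
    where
    vanish : ∀ {x} → x + b * 0# ≈ x + a * 0#
    vanish = +-congˡ (≈-trans (zeroʳ b) (≈-sym (zeroʳ a)))

  profile-swappable : ∀ a b n T B → Swappable a b (profile a b n T B) (profile b a n T B)
  profile-swappable a b zero    []      []      = leaf-swappable
  profile-swappable a b zero    []      (_ ∷ _) = zero-swappable
  profile-swappable a b zero    (_ ∷ _) B       = zero-swappable
  profile-swappable a b (suc n) []      B       = zero-swappable
  profile-swappable a b (suc n) (_ ∷ _) []      = zero-swappable
  profile-swappable a b (suc n) (s ∷ T) (r ∷ B) = step-swappable s r (profile-swappable a b n T B)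

  -- The matrices W_a and W_b commute: this is the bottom row of the relation, read at `u = 0`.
  weight-commute : ∀ a b n T B →
    ∑ (words n) (λ P → weight a 0 T P * weight b 0 P B) ≈
    ∑ (words n) (λ P → weight b 0 T P * weight a 0 P B)
  weight-commute a b n T B =
    conjugate (∑-weight≈profile a b n T B 0 0) (∑-weight≈profile b a n T B 0 0)
              (Swappable.bottom-≈ (profile-swappable a b n T B) 0)

  -- Products of the matrices and their symmetry.

  -- The (P, B) entry of the product of the matrices `weight z 0`, z ∈ zs.  The
  -- empty list is junk.
  transfer : ℕ → List Carrier → Path → Path → Carrier
  transfer n []                P B = 0#
  transfer n (z ∷ [])          P B = weight z 0 P B
  transfer n (z ∷ zs@(_ ∷ _))  P B = ∑ (words n) (λ Q → weight z 0 P Q * transfer n zs Q B)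

  *-support : ∀ {P Q R p q} → p ≈ 0# ⊎ Above 0 P Q → q ≈ 0# ⊎ Above 0 Q R → p * q ≈ 0# ⊎ Above 0 P R
  *-support (inj₁ eq) _         = inj₁ (≈-trans (*-congʳ eq) (zeroˡ _))
  *-support (inj₂ _)  (inj₁ eq) = inj₁ (≈-trans (*-congˡ eq) (zeroʳ _))
  *-support (inj₂ a)  (inj₂ b)  = inj₂ (above-trans a b)

  -- This serves to compare the sums over all words in `transfer` with sums over paths between T and
  -- B.
  transfer-support : ∀ n zs P B → transfer n zs P B ≈ 0# ⊎ Above 0 P B
  transfer-support n []           P B = inj₁ ≈-refl
  transfer-support n (z ∷ [])     P B = weight-support z 0 P B
  transfer-support n (z ∷ y ∷ zs) P B =
    ∑-support (words n) (λ Q → *-support (weight-support z 0 P Q) (transfer-support n (y ∷ zs) Q B))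

  -- Associativity of the matrix product: the first two factors are brought together so that they
  -- can be exchanged.
  transfer₂ : ∀ n x y z zs P B →
    transfer n (x ∷ y ∷ z ∷ zs) P B ≈
    ∑ (words n) (λ Q → ∑ (words n) (λ P′ → weight x 0 P P′ * weight y 0 P′ Q) * transfer n (z ∷ zs) Q B)
  transfer₂ n x y z zs P B = begin
    ∑ (words n) (λ P′ → weight x 0 P P′ * ∑ (words n) (λ Q → weight y 0 P′ Q * t Q))
      ≈⟨ ∑-cong (words n) (λ P′ → ≈-sym (∑-scaleˡ _ (words n) _)) ⟩
    ∑ (words n) (λ P′ → ∑ (words n) (λ Q → weight x 0 P P′ * (weight y 0 P′ Q * t Q)))
      ≈⟨ ∑-swap (words n) (words n) _ ⟩
    ∑ (words n) (λ Q → ∑ (words n) (λ P′ → weight x 0 P P′ * (weight y 0 P′ Q * t Q)))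
      ≈⟨ ∑-cong (words n) (λ Q → ∑-cong (words n) (λ P′ → ≈-sym (*-assoc _ _ _))) ⟩
    ∑ (words n) (λ Q → ∑ (words n) (λ P′ → (weight x 0 P P′ * weight y 0 P′ Q) * t Q))
      ≈⟨ ∑-cong (words n) (λ Q → ∑-scaleʳ (t Q) (words n) _) ⟩
    ∑ (words n) (λ Q → ∑ (words n) (λ P′ → weight x 0 P P′ * weight y 0 P′ Q) * t Q) ∎
    where
    t : Path → Carrier
    t Q = transfer n (z ∷ zs) Q B

  -- A one-element list gives a bare entry and a longer one a sum, so `xs` and `ys` must be both
  -- empty or both nonempty; the permutation ensures this by length.
  transfer-prep : ∀ n z {xs ys} → xs ↭ ys → (∀ P B → transfer n xs P B ≈ transfer n ys P B) →
                  ∀ P B → transfer n (z ∷ xs) P B ≈ transfer n (z ∷ ys) P B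
  transfer-prep n z {[]}     {[]}     p eq P B = ≈-refl
  transfer-prep n z {[]}     {_ ∷ _}  p eq P B with () ← ↭-length p
  transfer-prep n z {_ ∷ _}  {[]}     p eq P B with () ← ↭-length p
  transfer-prep n z {_ ∷ _}  {_ ∷ _}  p eq P B = ∑-cong (words n) (λ Q → *-congˡ (eq Q B))

  transfer-swap : ∀ n x y zs P B → transfer n (x ∷ y ∷ zs) P B ≈ transfer n (y ∷ x ∷ zs) P B
  transfer-swap n x y []       P B = weight-commute x y n P B
  transfer-swap n x y (z ∷ zs) P B =
    conjugate (transfer₂ n x y z zs P B) (transfer₂ n y x z zs P B)
              (∑-cong (words n) (λ Q → *-congʳ (weight-commute x y n P Q)))

  transfer-↭ : ∀ n {xs ys} → xs ↭ ys → ∀ P B → transfer n xs P B ≈ transfer n ys P B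
  transfer-↭ n refl          P B = ≈-refl
  transfer-↭ n (prep x p)    P B = transfer-prep n x p (transfer-↭ n p) P B
  transfer-↭ n (swap {ys = ys} x y p) P B =
    ≈-trans (transfer-prep n x (prep y p) (transfer-prep n y p (transfer-↭ n p)) P B)
            (transfer-swap n x y ys P B)
  transfer-↭ n (trans p q)   P B = ≈-trans (transfer-↭ n p P B) (transfer-↭ n q P B)

  -- Finite products and Boolean guards.

  ∏ : ∀ n → (Fin n → Carrier) → Carrier
  ∏ = prodFin R

  ∏-permute : ∀ {n} (f : Fin n → Carrier) (π : Permutation′ n) → ∏ n f ≈ ∏ n (f ∘ (π ⟨$⟩ʳ_))
  ∏-permute f π = conjugate (∏≈sum f) (∏≈sum (f ∘ (π ⟨$⟩ʳ_))) (sum-permute f π)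
    where
    open MonoidSum *-commutativeMonoid using (sum; sum-permute)
    ∏≈sum : ∀ {n} (f : Fin n → Carrier) → ∏ n f ≈ sum f
    ∏≈sum {zero}  f = ≈-refl
    ∏≈sum {suc n} f = *-congˡ (∏≈sum (f ∘ fsuc))

  ∏-cong : ∀ n {f g : Fin n → Carrier} → (∀ i → f i ≈ g i) → ∏ n f ≈ ∏ n g
  ∏-cong zero    eq = ≈-refl
  ∏-cong (suc n) eq = *-cong (eq fzero) (∏-cong n (eq ∘ fsuc))

  if-* : ∀ p q {x y} → (if p ∧ q then x * y else 0#) ≈ (if p then x else 0#) * (if q then y else 0#)
  if-* true  true  = ≈-refl
  if-* true  false = ≈-sym (zeroʳ _)
  if-* false q     = ≈-sym (zeroˡ _)

  if-∧ : ∀ p q {x} → (if p then (if q then x else 0#) else 0#) ≈ (if p ∧ q then x else 0#)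
  if-∧ true  q = ≈-refl
  if-∧ false q = ≈-refl

  if-≈ : ∀ p {x y} → (p ≡ true → x ≈ y) → (p ≢ true → y ≈ 0#) → (if p then x else 0#) ≈ y
  if-≈ true  t f = t ≡.refl
  if-≈ false t f = ≈-sym (f λ ())

  -- Multipaths as entries of a matrix product.

  module Between {x y : ℕ} {T B : Path}
                 (endsT : endsAtᵇ x y T ≡ true) (endsB : endsAtᵇ x y B ≡ true) where

    -- The top path is a parameter so that an induction can replace it by the first path of the
    -- tuple.
    monomial : ∀ {k} → (Fin (suc k) → Carrier) → Path → Vec Path k → Carrier
    monomial {k} z P Ps = ∏ (suc k) (λ i → pow R (z i) (h P B Ps i))

    isBetween : Path → Bool
    isBetween Q = endsAtᵇ x y Q ∧ (weaklyAboveᵇ T Q ∧ weaklyAboveᵇ Q B)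

    isBetween-sound : ∀ Q → isBetween Q ≡ true → Above 0 T Q × Above 0 Q B
    isBetween-sound Q eq with Equivalence.to T-∧ (fromTrue eq)
    ... | e , tb with Equivalence.to (T-∧ {weaklyAboveᵇ T Q}) tb
    ... | t , b = weaklyAbove-above endsT (toTrue e) (toTrue t) , weaklyAbove-above (toTrue e) endsB (toTrue b)

    isBetween-complete : ∀ Q → Above 0 T Q → Above 0 Q B → isBetween Q ≡ true
    isBetween-complete Q t b =
      ≡.cong₂ _∧_ (≡.trans (≡.sym (above-endsAt t)) endsT) (≡.cong₂ _∧_ (above-aboveAux 0 t) (above-aboveAux 0 b))

    -- Induction on k, peeling off the first path Q: the chain test and the monomial each split into
    -- a part for P and Q and the same expression with top path Q.
    ∑-chain : ∀ k (z : Fin (suc k) → Carrier) P → Above 0 T P → Above 0 P B →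
      ∑ (tuples k (pathsBetween x y T B)) (λ Ps → if chainᵇ (P ∷ Ps) then monomial z P Ps else 0#)
      ≈ transfer (x ℕ.+ y) (tabulate z) P B
    ∑-chain zero z P t b = begin
      (pow R (z fzero) (commonE P B) * 1#) + 0# ≈⟨ +-identityʳ _ ⟩
      pow R (z fzero) (commonE P B) * 1#        ≈⟨ *-identityʳ _ ⟩
      pow R (z fzero) (commonE P B)             ≡⟨ ≡.cong (λ c → if c then pow R (z fzero) (commonE P B) else 0#) (above-aboveAux 0 b) ⟨
      guardedPow (z fzero) 0 0 P B              ≈⟨ guardedPow≈weight (z fzero) 0 0 P B (above-countN b) ⟩
      weight (z fzero) 0 P B                    ∎
    ∑-chain (suc k) z P t b = begin
      ∑ (tuples (suc k) Qs) _
        ≈⟨ ∑-concatMap _ Qs _ ⟩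
      ∑ Qs (λ Q → ∑ (map (Q ∷_) (tuples k Qs)) (λ Ps → if chainᵇ (P ∷ Ps) then monomial z P Ps else 0#))
        ≈⟨ ∑-cong Qs (λ Q → ≈-trans (∑-map (Q ∷_) (tuples k Qs) _) (∑-cong (tuples k Qs) (λ _ → if-* (weaklyAboveᵇ P Q) _))) ⟩
      ∑ Qs (λ Q → ∑ (tuples k Qs) (λ Ps → guardedPow (z fzero) 0 0 P Q * (if chainᵇ (Q ∷ Ps) then monomial z′ Q Ps else 0#)))
        ≈⟨ ∑-cong Qs (λ Q → ∑-scaleˡ _ (tuples k Qs) _) ⟩
      ∑ Qs summand
        ≈⟨ ∑-filter _ (allPaths x y) _ ⟩
      ∑ (allPaths x y) _
        ≈⟨ ∑-filter _ (words (x ℕ.+ y)) _ ⟩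
      ∑ (words (x ℕ.+ y)) _
        -- The sum now runs over all words; those that are not paths between T and B contribute `0#`
        -- to the matrix product.
        ≈⟨ ∑-cong (words (x ℕ.+ y)) (λ Q → ≈-trans (if-∧ (endsAtᵇ x y Q) _) (if-≈ (isBetween Q) (inside Q) (outside Q))) ⟩
      ∑ (words (x ℕ.+ y)) (λ Q → weight (z fzero) 0 P Q * transfer (x ℕ.+ y) (tabulate z′) Q B) ∎
      where
      Qs : List Path
      Qs = pathsBetween x y T B
      z′ : Fin (suc k) → Carrier
      z′ = z ∘ fsuc
      summand : Path → Carrier
      summand Q = guardedPow (z fzero) 0 0 P Q * ∑ (tuples k Qs) (λ Ps → if chainᵇ (Q ∷ Ps) then monomial z′ Q Ps else 0#)
      inside : ∀ Q → isBetween Q ≡ true → summand Q ≈ weight (z fzero) 0 P Q * transfer (x ℕ.+ y) (tabulate z′) Q B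
      inside Q eq with isBetween-sound Q eq
      ... | t′ , b′ = *-cong
        (guardedPow≈weight (z fzero) 0 0 P Q (≡.trans (above-countN b) (≡.sym (above-countN b′))))
        (∑-chain k z′ Q t′ b′)
      outside : ∀ Q → isBetween Q ≢ true → weight (z fzero) 0 P Q * transfer (x ℕ.+ y) (tabulate z′) Q B ≈ 0#
      outside Q neq with weight-support (z fzero) 0 P Q | transfer-support (x ℕ.+ y) (tabulate z′) Q B
      ... | inj₁ eq | _       = ≈-trans (*-congʳ eq) (zeroˡ _)
      ... | inj₂ _  | inj₁ eq = ≈-trans (*-congˡ eq) (zeroʳ _)
      -- Here T, P, Q, B is a chain, so Q would lie between T and B.
      ... | inj₂ p  | inj₂ q  = ⊥-elim (neq (isBetween-complete Q (above-trans t p) q))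

    -- Every member of `pathsBetween` lies below T, so T may be put at the head of the chain;
    -- `∑-first` exposes the first path of the tuple for this purpose.
    ∑-multiPaths : Above 0 T B → ∀ k (z : Fin (suc (suc k)) → Carrier) →
      ∑ (multiPaths x y T B (suc k)) (monomial z T) ≈ transfer (x ℕ.+ y) (tabulate z) T B
    ∑-multiPaths tb k z = begin
      ∑ (multiPaths x y T B (suc k)) (monomial z T)
        ≈⟨ ∑-filter chainᵇ (tuples (suc k) Qs) _ ⟩
      ∑ (tuples (suc k) Qs) (λ Ps → if chainᵇ Ps then monomial z T Ps else 0#)
        ≈⟨ conjugate (∑-first _) (∑-first _) (∑-cong (words (x ℕ.+ y)) underT) ⟩
      ∑ (tuples (suc k) Qs) (λ Ps → if chainᵇ (T ∷ Ps) then monomial z T Ps else 0#)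
        ≈⟨ ∑-chain (suc k) z T (above-refl T) tb ⟩
      transfer (x ℕ.+ y) (tabulate z) T B ∎
      where
      Qs : List Path
      Qs = pathsBetween x y T B
      ∑-first : ∀ f → ∑ (tuples (suc k) Qs) f ≈
        ∑ (words (x ℕ.+ y)) (λ Q → if isBetween Q then ∑ (tuples k Qs) (λ Ps → f (Q ∷ Ps)) else 0#)
      ∑-first f = begin
        ∑ (tuples (suc k) Qs) f                           ≈⟨ ∑-concatMap _ Qs f ⟩
        ∑ Qs (λ Q → ∑ (map (Q ∷_) (tuples k Qs)) f)       ≈⟨ ∑-cong Qs (λ Q → ∑-map (Q ∷_) (tuples k Qs) f) ⟩
        ∑ Qs (λ Q → ∑ (tuples k Qs) (λ Ps → f (Q ∷ Ps)))  ≈⟨ ∑-filter _ (allPaths x y) _ ⟩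
        ∑ (allPaths x y) _                                ≈⟨ ∑-filter _ (words (x ℕ.+ y)) _ ⟩
        ∑ (words (x ℕ.+ y)) _                             ≈⟨ ∑-cong (words (x ℕ.+ y)) (λ Q → if-∧ (endsAtᵇ x y Q) _) ⟩
        _                                                 ∎
      underT : ∀ Q →
        (if isBetween Q then ∑ (tuples k Qs) (λ Ps → if chainᵇ (Q ∷ Ps) then monomial z T (Q ∷ Ps) else 0#) else 0#) ≈
        (if isBetween Q then ∑ (tuples k Qs) (λ Ps → if weaklyAboveᵇ T Q ∧ chainᵇ (Q ∷ Ps) then monomial z T (Q ∷ Ps) else 0#) else 0#)
      underT Q with isBetween Q in eq
      ... | false = ≈-refl
      ... | true rewrite above-aboveAux 0 (proj₁ (isBetween-sound Q eq)) = ≈-refl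

theorem2p3 : {c ℓ : Level} (R : CommutativeSemiring c ℓ) (x y : ℕ) (T B : Path) →
    endsAtᵇ x y T ≡ true → endsAtᵇ x y B ≡ true → weaklyAboveᵇ T B ≡ true →
    (k : ℕ) → 1 ≤ k → (π : Permutation′ (suc k)) →
    (z : Fin (suc k) → CommutativeSemiring.Carrier R) →
    CommutativeSemiring._≈_ R
    (sumList R (multiPaths x y T B k)
    (λ P → prodFin R (suc k) (λ i → pow R (z i) (h T B P i))))
    (sumList R (multiPaths x y T B k)
    (λ P → prodFin R (suc k) (λ i → pow R (z i) (h T B P (π ⟨$⟩ʳ i)))))
theorem2p3 R x y T B endsT endsB T≥B (suc k) (s≤s _) π z = begin
  ∑ paths (monomial z T)                      ≈⟨ ∑-multiPaths tb k z ⟩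
  -- Permuting the statistics by π amounts to permuting the variables by its inverse, hence
  -- `flip π`.
  transfer (x ℕ.+ y) (tabulate z) T B         ≈⟨ transfer-↭ (x ℕ.+ y) (tabulate-permute z (flip π)) T B ⟩
  transfer (x ℕ.+ y) (tabulate z∘π⁻¹) T B     ≈⟨ ∑-multiPaths tb k z∘π⁻¹ ⟨
  ∑ paths (monomial z∘π⁻¹ T)                  ≈⟨ ∑-cong paths reindex ⟩
  _                                           ∎
  where
  open CommutativeSemiring R using (Carrier; _≈_; setoid; reflexive) renaming (trans to ≈-trans)
  open Weights R
  open Between {x} {y} {T} {B} endsT endsB
  open SetoidReasoning setoid
  paths : List (Vec Path (suc k))
  paths = multiPaths x y T B (suc k)
  tb : Above 0 T B
  tb = weaklyAbove-above endsT endsB T≥B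
  z∘π⁻¹ : Fin (suc (suc k)) → Carrier
  z∘π⁻¹ i = z (π ⟨$⟩ˡ i)
  reindex : ∀ Ps → monomial z∘π⁻¹ T Ps ≈ prodFin R (suc (suc k)) (λ i → pow R (z i) (h T B Ps (π ⟨$⟩ʳ i)))
  -- After reindexing by π, the factor at `π ⟨$⟩ʳ i` carries the variable `z i`, since the inverse
  -- cancels π.
  reindex Ps = ≈-trans (∏-permute (λ j → pow R (z∘π⁻¹ j) (h T B Ps j)) π)
    (∏-cong (suc (suc k)) (λ i → reflexive (≡.cong (λ j → pow R (z j) (h T B Ps (π ⟨$⟩ʳ i))) (inverseˡ π {i}))))
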